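{- Let $\Sigma$ be a finite set of $n\times n$ matrices with nonnegative integer entries and $\rho(\Sigma)=1$, let $k$ be its rate of growth, and let $I$ be the number of strongly connected components of the graph $G(\Sigma)$. Then $k\le I-1$. In particular, $k\le n-1$.
   Context: For a finite nonempty set $\Sigma$ of $n\times n$ matrices and $t\ge 1$, $\max_t(\Sigma)=\max\{\|A_1\cdots A_t\| : A_i\in\Sigma\}$, where $\|\cdot\|$ is the sum of the absolute values of all entries. The joint spectral radius is $\rho(\Sigma)=\lim_{t\to\infty}\max_t(\Sigma)^{1/t}$. For a finite set $\Sigma$ of nonnegative integer matrices with $\rho(\Sigma)=1$ there is a unique integer $k\ge 0$ (called the rate of growth) for which there exist positive constants $C_1,C_2$ with $C_1t^k\le\max_t(\Sigma)\le C_2t^k$ for all integers $t\ge 1$. The directed graph $G(\Sigma)$ has node set $\{1,\dots,n\}$ and an edge from $i$ to $j$ (loops allowed) if and only if $A_{i,j}>0$ for some $A\in\Sigma$. Its nodes are partitioned into maximal strongly connected sets $V_1,\dots,V_I$; by convention a node not strongly connected to any other node forms a component by itself, even if it has no self-loop. -}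

module Defs where

open import Algebra.Definitions.RawSemiring using () renaming (_^_ to pow)
open import Algebra.Properties.CommutativeMonoid.Sum using (sum)
open import Data.Fin using (Fin; _≟_)
open import Data.Integer using (+_)
open import Data.List using (List; []; _∷_; map; cartesianProductWith)
open import Data.List.Extrema.Nat using (max)
open import Data.List.NonEmpty using (List⁺; toList)
open import Data.List.Relation.Unary.Any using (Any)
open import Data.Nat using (ℕ; zero; suc; NonZero)
open import Data.Nat.Properties using (+-0-commutativeMonoid)
open import Data.Product using (_×_; ∃-syntax)
open import Data.Rational using (ℚ; _+_; _-_; _*_; _/_; _≤_; _<_; 0ℚ; +-*-rawSemiring)
open import Data.Sum using (_⊎_)
open import Data.Vec using (Vec; []; _∷_; foldr′)
open import Data.Vec.Functional using (Vector)
open import Data.Bool using (if_then_else_)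
open import Function using (_∘_; Bijection)
open import Relation.Binary using (Rel; Setoid)
open import Relation.Binary.Construct.Closure.ReflexiveTransitive using (Star; ε; _◅◅_)
open import Relation.Binary.Construct.Interior.Symmetric using (SymInterior; isEquivalence)
open import Relation.Binary.PropositionalEquality using (setoid)
open import Relation.Nullary using (does)
open import Level using (0ℓ)
import Data.Nat as ℕ

∑ : ∀ {n} → Vector ℕ n → ℕ
∑ = sum +-0-commutativeMonoid

infixr 8 _^_
_^_ : ℚ → ℕ → ℚ
_^_ = pow +-*-rawSemiring

fromℕ : ℕ → ℚ
fromℕ m = + m / 1

Matrix : ℕ → Set
Matrix n = Vector (Vector ℕ n) n

𝟙 : ∀ {n} → Matrix n
𝟙 i j = if does (i ≟ j) then 1 else 0

infixl 7 _⊗_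
_⊗_ : ∀ {n} → Matrix n → Matrix n → Matrix n
(A ⊗ B) i j = ∑ λ l → A i l ℕ.* B l j

-- The entries are natural numbers, so they are their own absolute values.
‖_‖ : ∀ {n} → Matrix n → ℕ
‖ A ‖ = ∑ λ i → ∑ λ j → A i j

product : ∀ {n t} → Vec (Matrix n) t → Matrix n
product = foldr′ _⊗_ 𝟙

words : ∀ {a} {A : Set a} → List A → ∀ t → List (Vec A t)
words xs zero    = [] ∷ []
words xs (suc t) = cartesianProductWith _∷_ xs (words xs t)

-- A finite nonempty set of matrices is given by a nonempty list enumerating it;
-- order and repetitions do not affect anything below.  Since the list is
-- nonempty and norms are ≥ 0, the default value 0 of max is immaterial.
maxₜ : ∀ {n} → List⁺ (Matrix n) → ℕ → ℕ
maxₜ S t = max 0 (map (‖_‖ ∘ product) (words (toList S) t))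

-- For t ≥ 1 the real number m^(1/t) ≥ 0 is given by its two rational cuts:
-- x <√[ t ] m  says  x < m^(1/t),  and  √[ t ] m < x  says  m^(1/t) < x.
infix 4 _<√[_]_ √[_]_<_
_<√[_]_ : ℚ → ℕ → ℕ → Set
x <√[ t ] m = x < 0ℚ ⊎ x ^ t < fromℕ m

√[_]_<_ : ℕ → ℕ → ℚ → Set
√[ t ] m < x = 0ℚ < x × fromℕ m < x ^ t

-- ρ(S) = lim maxₜ(S)^(1/t) exists and equals the rational number r.
IsJointSpectralRadius : ∀ {n} → List⁺ (Matrix n) → ℚ → Set
IsJointSpectralRadius S r =
  ∀ δ → 0ℚ < δ →
  ∃[ T ] ∀ t → .{{NonZero t}} → T ℕ.≤ t →
    (r - δ) <√[ t ] maxₜ S t × √[ t ] maxₜ S t < (r + δ)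

-- Rational constants are as good as real ones: C₁ may be decreased and C₂
-- increased.
IsRateOfGrowth : ∀ {n} → List⁺ (Matrix n) → ℕ → Set
IsRateOfGrowth S k =
  ∃[ C₁ ] ∃[ C₂ ] 0ℚ < C₁ × 0ℚ < C₂ ×
    (∀ t → .{{NonZero t}} →
      C₁ * fromℕ (t ℕ.^ k) ≤ fromℕ (maxₜ S t) ×
      fromℕ (maxₜ S t) ≤ C₂ * fromℕ (t ℕ.^ k))

Edge : ∀ {n} → List⁺ (Matrix n) → Rel (Fin n) 0ℓ
Edge S i j = Any (λ A → 0 ℕ.< A i j) (toList S)

-- Star includes the empty path, so a node not strongly connected to any other
-- node is a class by itself even without a self-loop.
StronglyConnected : ∀ {n} → List⁺ (Matrix n) → Rel (Fin n) 0ℓ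
StronglyConnected S = SymInterior (Star (Edge S))

-- Nodes up to strong connectedness: the elements of this setoid are the
-- strongly connected components.
components : ∀ {n} → List⁺ (Matrix n) → Setoid 0ℓ 0ℓ
components {n} S = record
  { Carrier       = Fin n
  ; _≈_           = StronglyConnected S
  ; isEquivalence = isEquivalence ε _◅◅_
  }

NumberOfComponents : ∀ {n} → List⁺ (Matrix n) → ℕ → Set
NumberOfComponents S I = Bijection (components S) (setoid (Fin I))

{-# OPTIONS --safe #-}

-- Polynomial growth forces every diagonal entry of every product to be at most
-- 1, since an entry ≥ 2 would double with each repetition of the word.  Closing
-- a path up to a cycle extends this to all entries (i , j) with i and j strongly
-- connected.  Reading an entry of a product as a weighted number of paths, a
-- path leaves its current component at one of at most t times and never
-- returns, so a component from which at most d components are reachable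
-- contributes O(t ^ (d - 1)).  Reachability is assumed decidable under a double
-- negation, which is harmless because the conclusion is decidable.

module Submission where

open import Defs
open import Data.Bool using (true; false; if_then_else_)
open import Data.Fin using (Fin; zero; suc; _≟_)
open import Data.Fin.Properties using (sequence)
open import Data.Fin.Subset using (Subset; ∣_∣; _∈_)
open import Data.Fin.Subset.Properties using (p⊂q⇒∣p∣<∣q∣; ∣p∣≤n; x∈p⇒∣p-x∣<∣p∣)
open import Data.Integer using (+_; _-_; _≤_)
open import Data.List using (map)
open import Data.List.Extrema.Nat using (max; max≤v⁺; xs≤max)
open import Data.List.Membership.Propositional using (find; lose) renaming (_∈_ to _∈ˡ_)
open import Data.List.Membership.Propositional.Properties using (∈-cartesianProductWith⁺; ∈-cartesianProductWith⁻; ∈-map⁺)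
open import Data.List.NonEmpty using (List⁺; toList)
open import Data.List.Relation.Unary.Any using (here)
open import Data.Nat using (ℕ; zero; suc; _+_; _*_; NonZero; z≤n; s≤s; s≤s⁻¹; z<s)
open import Data.Nat.Properties hiding (_≟_)
open import Data.Nat.Solver using (module +-*-Solver)
open import Data.Product using (_×_; _,_; proj₁; proj₂; ∃-syntax)
open import Data.Rational using (mkℚ; 0ℚ; 1ℚ; toℚᵘ)
open import Data.Rational.Unnormalised using (mkℚᵘ)
open import Data.Vec using (Vec; []; _∷_; _++_; concat; replicate; tabulate)
open import Data.Vec.Functional using (Vector)
open import Data.Vec.Properties using ([]=⇒lookup; lookup⇒[]=; lookup∘tabulate)
open import Data.Vec.Relation.Unary.All using (All; []; _∷_)
open import Data.Vec.Relation.Unary.All.Properties using (++⁺)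
open import Effect.Monad using (RawMonad)
open import Function using (flip; _∘_; Bijection)
open import Relation.Binary.Construct.Closure.ReflexiveTransitive using (Star; ε; _◅_; _◅◅_)
open import Relation.Binary.Construct.Interior.Symmetric using (_,_; symmetric)
open import Relation.Binary.PropositionalEquality using (_≡_; refl; sym; trans; cong; cong₂; subst; subst₂)
open import Relation.Nullary using (¬_; Dec; yes; no; does; contradiction)
open import Relation.Nullary.Decidable using (dec-true; decidable-stable; ¬¬-excluded-middle)
open import Relation.Nullary.Negation using (¬¬-Monad; ¬¬-map)
import Algebra.Properties.Semiring.Sum
import Data.Integer as ℤ
import Data.Integer.Properties as ℤ
import Data.List.Relation.Unary.All as ListAll
import Data.List.Relation.Unary.All.Properties as ListAll
import Data.Nat as ℕ
import Data.Rational as ℚ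
import Data.Rational.Properties as ℚ
import Data.Rational.Unnormalised as ℚᵘ
import Data.Rational.Unnormalised.Properties as ℚᵘ

private module Sum = Algebra.Properties.Semiring.Sum +-*-semiring

private variable
  n t : ℕ

-- Finite sums of natural numbers

infix 7 _∙_
_∙_ : Vector ℕ n → Vector ℕ n → ℕ
u ∙ v = ∑ λ i → u i * v i

∑-mono : {f g : Vector ℕ n} → (∀ i → f i ℕ.≤ g i) → ∑ f ℕ.≤ ∑ g
∑-mono {zero}  f≤g = z≤n
∑-mono {suc n} f≤g = +-mono-≤ (f≤g zero) (∑-mono (f≤g ∘ suc))

term≤∑ : (f : Vector ℕ n) → ∀ i → f i ℕ.≤ ∑ f
term≤∑ f zero    = m≤m+n _ _
term≤∑ f (suc i) = ≤-trans (term≤∑ (f ∘ suc) i) (m≤n+m _ (f zero))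

∑-bounded : (f : Vector ℕ n) {b : ℕ} → (∀ i → f i ℕ.≤ b) → ∑ f ℕ.≤ n * b
∑-bounded {zero}  f f≤b = z≤n
∑-bounded {suc n} f f≤b = +-mono-≤ (f≤b zero) (∑-bounded (f ∘ suc) (f≤b ∘ suc))

∑-positive : (f : Vector ℕ n) → 0 ℕ.< ∑ f → ∃[ i ] 0 ℕ.< f i
∑-positive {suc n} f 0<∑ with f zero in eq
... | suc _ = zero , subst (0 ℕ.<_) (sym eq) z<s
... | zero  with i , 0<fi ← ∑-positive (f ∘ suc) 0<∑ = suc i , 0<fi

*-positive : ∀ a b → 0 ℕ.< a * b → 0 ℕ.< a × 0 ℕ.< b
*-positive (suc a) (suc b) _   = z<s , z<s
*-positive (suc a) zero    0<0 = contradiction (subst (0 ℕ.<_) (*-zeroʳ a) 0<0) λ ()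

∑-cong : {f g : Vector ℕ n} → (∀ i → f i ≡ g i) → ∑ f ≡ ∑ g
∑-cong = Sum.sum-cong-≗

∑-comm : ∀ {m n} (f : Fin m → Fin n → ℕ) → ∑ (λ i → ∑ (f i)) ≡ ∑ (λ j → ∑ (flip f j))
∑-comm = Sum.∑-comm

∑-distrib-+ : (f g : Vector ℕ n) → ∑ (λ i → f i + g i) ≡ ∑ f + ∑ g
∑-distrib-+ = Sum.∑-distrib-+

*-distribˡ-∑ : ∀ a (f : Vector ℕ n) → a * ∑ f ≡ ∑ (λ i → a * f i)
*-distribˡ-∑ = Sum.*-distribˡ-sum

*-distribʳ-∑ : ∀ a (f : Vector ℕ n) → ∑ f * a ≡ ∑ (λ i → f i * a)
*-distribʳ-∑ = Sum.*-distribʳ-sum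

-- Moves the first letter of a word onto the row vector, so that induction on the word can run with
-- a changing `q`.
∙-assoc : (q : Vector ℕ n) (A : Matrix n) (s : Vector ℕ n) →
          q ∙ (λ l → A l ∙ s) ≡ (λ j → q ∙ flip A j) ∙ s
∙-assoc q A s = begin-equality
  (∑ λ l → q l * ∑ λ j → A l j * s j)   ≡⟨ ∑-cong (λ l → *-distribˡ-∑ (q l) (λ j → A l j * s j)) ⟩
  (∑ λ l → ∑ λ j → q l * (A l j * s j)) ≡⟨ ∑-comm (λ l j → q l * (A l j * s j)) ⟩
  (∑ λ j → ∑ λ l → q l * (A l j * s j)) ≡⟨ ∑-cong (λ j → ∑-cong λ l → *-assoc (q l) (A l j) (s j)) ⟨
  (∑ λ j → ∑ λ l → q l * A l j * s j)   ≡⟨ ∑-cong (λ j → *-distribʳ-∑ (s j) (λ l → q l * A l j)) ⟨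
  (∑ λ j → (∑ λ l → q l * A l j) * s j) ∎
  where open ≤-Reasoning

𝟙-∙ : (i : Fin n) (f : Vector ℕ n) → 𝟙 i ∙ f ≡ f i
𝟙-∙ {suc n} zero    f = trans (cong₂ _+_ (*-identityˡ (f zero)) (Sum.sum-replicate-zero n)) (+-identityʳ _)
𝟙-∙ {suc n} (suc i) f = 𝟙-∙ i (f ∘ suc)

𝟙-diagonal : (i : Fin n) → 𝟙 i i ≡ 1
𝟙-diagonal i = cong (if_then 1 else 0) (dec-true (i ≟ i) refl)

-- Products of words

rowSum : Matrix n → Vector ℕ n
rowSum A i = ∑ (A i)

rowSum-𝟙 : (i : Fin n) → rowSum 𝟙 i ≡ 1
rowSum-𝟙 i = trans (sym (∑-cong λ j → *-identityʳ (𝟙 i j))) (𝟙-∙ i λ _ → 1)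

rowSum-⊗ : (A B : Matrix n) → ∀ i → rowSum (A ⊗ B) i ≡ A i ∙ rowSum B
rowSum-⊗ A B i = trans (∑-comm λ j l → A i l * B l j)
  (sym (∑-cong λ l → *-distribˡ-∑ (A i l) (B l)))

entry≤norm : (A : Matrix n) → ∀ i j → A i j ℕ.≤ ‖ A ‖
entry≤norm A i j = ≤-trans (term≤∑ (A i) j) (term≤∑ (rowSum A) i)

-- Only the paths that stand at `l` when `v` ends are kept, hence an inequality.
product-++ : ∀ {s t} (v : Vec (Matrix n) s) (w : Vec (Matrix n) t) → ∀ i l j →
             product v i l * product w l j ℕ.≤ product (v ++ w) i j
product-++ [] w i l j = subst (𝟙 i l * product w l j ℕ.≤_) (𝟙-∙ i (flip (product w) j)) (term≤∑ _ l)
product-++ (A ∷ v) w i l j = begin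
  (A i ∙ flip (product v) l) * product w l j           ≡⟨ *-distribʳ-∑ (product w l j) (λ m → A i m * product v m l) ⟩
  (∑ λ m → A i m * product v m l * product w l j)      ≡⟨ ∑-cong (λ m → *-assoc (A i m) _ _) ⟩
  (∑ λ m → A i m * (product v m l * product w l j))    ≤⟨ ∑-mono (λ m → *-monoʳ-≤ (A i m) (product-++ v w m l j)) ⟩
  A i ∙ flip (product (v ++ w)) j                      ∎
  where open ≤-Reasoning

-- Each further round of closed paths at `i` multiplies their count by at least 2.
product-power : (v : Vec (Matrix n) t) → ∀ i → 2 ℕ.≤ product v i i →
                ∀ m → 2 ℕ.^ m ℕ.≤ product (concat (replicate m v)) i i
product-power v i 2≤ zero    = ≤-reflexive (sym (𝟙-diagonal i))
product-power v i 2≤ (suc m) =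
  ≤-trans (*-mono-≤ 2≤ (product-power v i 2≤ m)) (product-++ v (concat (replicate m v)) i i i)

-- Growth of natural sequences

n<2^n : ∀ n → n ℕ.< 2 ℕ.^ n
n<2^n zero    = z<s
n<2^n (suc n) = +-mono-≤ (≤-trans z<s (n<2^n n)) (≤-trans (n<2^n n) (m≤m+n _ 0))

^-distribʳ-* : ∀ k m n → (m * n) ℕ.^ k ≡ m ℕ.^ k * n ℕ.^ k
^-distribʳ-* zero    m n = refl
^-distribʳ-* (suc k) m n = trans (cong (m * n *_) (^-distribʳ-* k m n)) ([m*n]*[o*p]≡[m*o]*[n*p] m n (m ℕ.^ k) (n ℕ.^ k))

-- The witness is m = 2 ^ (i + i) with i = D + 2 * k, for which D + (i + i) * k ≤ m.
exponential-beats-polynomial : ∀ D k → ∃[ m ] NonZero m × D * m ℕ.^ k ℕ.< 2 ℕ.^ m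
exponential-beats-polynomial D k = 2 ℕ.^ j , m^n≢0 2 j , (begin-strict
  D * (2 ℕ.^ j) ℕ.^ k          ≡⟨ cong (D *_) (^-*-assoc 2 j k) ⟩
  D * 2 ℕ.^ (j * k)            <⟨ *-monoˡ-< (2 ℕ.^ (j * k)) {{m^n≢0 2 (j * k)}} (n<2^n D) ⟩
  2 ℕ.^ D * 2 ℕ.^ (j * k)      ≡⟨ ^-distribˡ-+-* 2 D (j * k) ⟨
  2 ℕ.^ (D + j * k)            ≤⟨ ^-monoʳ-≤ 2 exponent ⟩
  2 ℕ.^ (2 ℕ.^ j)              ∎)
  where
  open ≤-Reasoning
  open +-*-Solver
  i j : ℕ
  i = D + 2 * k
  j = i + i

  exponent : D + j * k ℕ.≤ 2 ℕ.^ j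
  exponent = begin
    D + (i + i) * k    ≡⟨ solve 3 (λ x y z → x :+ (y :+ y) :* z := x :+ y :* (con 2 :* z)) refl D i k ⟩
    D + i * (2 * k)    ≤⟨ +-mono-≤ (m≤m+n D (2 * k)) (*-monoʳ-≤ i (m≤n+m (2 * k) D)) ⟩
    suc i * i          ≤⟨ *-mono-≤ (n<2^n i) (<⇒≤ (n<2^n i)) ⟩
    2 ℕ.^ i * 2 ℕ.^ i  ≡⟨ ^-distribˡ-+-* 2 i i ⟨
    2 ℕ.^ j            ∎

-- If `d < k`, the single value `t = suc F` refutes the bound: it would give
-- `suc F * suc F ^ d ≤ F * suc F ^ d`.
degree-≤ : ∀ k d F → (∀ t → .{{NonZero t}} → t ℕ.^ k ℕ.≤ F * t ℕ.^ d) → k ℕ.≤ d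
degree-≤ k d F bound with k ≤? d
... | yes k≤d = k≤d
... | no  k≰d = contradiction (*-cancelʳ-≤ (suc F) F (suc F ℕ.^ d) {{m^n≢0 (suc F) d}}
  (≤-trans (^-monoʳ-≤ (suc F) (≰⇒> k≰d)) (bound (suc F)))) (<-irrefl refl)

-- Rational bounds on naturals

-- Passing to unnormalised fractions makes an inequality unfold to cross-multiplied integers, past
-- the normalisation inside `fromℕ`.
toℚᵘ-fromℕ : ∀ a → toℚᵘ (fromℕ a) ℚᵘ.≃ mkℚᵘ (+ a) 0
toℚᵘ-fromℕ a = ℚ.toℚᵘ-fromℚᵘ (mkℚᵘ (+ a) 0)

toℚᵘ-*-fromℕ : ∀ C a → toℚᵘ (C ℚ.* fromℕ a) ℚᵘ.≃ toℚᵘ C ℚᵘ.* mkℚᵘ (+ a) 0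
toℚᵘ-*-fromℕ C a = ℚᵘ.≃-trans (ℚ.toℚᵘ-homo-* C (fromℕ a)) (ℚᵘ.*-congˡ {toℚᵘ C} (toℚᵘ-fromℕ a))

pos-*-* : ∀ a b c → + a ℤ.* + b ℤ.* + c ≡ + (a * b * c)
pos-*-* a b c = trans (cong (ℤ._* + c) (sym (ℤ.pos-* a b))) (sym (ℤ.pos-* (a * b) c))

-- For `C` with numerator `suc p` and denominator `suc d`, the denominator serves as `D`, because
-- the numerator is at least 1.
lower-bound-ℕ : ∀ C → 0ℚ ℚ.< C →
                ∃[ D ] (∀ a b → C ℚ.* fromℕ a ℚ.≤ fromℕ b → a ℕ.≤ D * b)
lower-bound-ℕ (mkℚ (+ zero) _ _)      0<C = contradiction (ℚ.drop-*<* 0<C) λ { (ℤ.+<+ ()) }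
lower-bound-ℕ (mkℚ ℤ.-[1+ _ ] _ _)    0<C = contradiction (ℚ.drop-*<* 0<C) λ ()
lower-bound-ℕ C@(mkℚ (+ suc p) d _)   0<C = suc d , λ a b le → drop a b
  (ℚᵘ.≤-respʳ-≃ (toℚᵘ-fromℕ b) (ℚᵘ.≤-respˡ-≃ (toℚᵘ-*-fromℕ C a) (ℚ.toℚᵘ-mono-≤ le)))
  where
  open ≤-Reasoning
  drop : ∀ a b → mkℚᵘ (+ suc p) d ℚᵘ.* mkℚᵘ (+ a) 0 ℚᵘ.≤ mkℚᵘ (+ b) 0 → a ℕ.≤ suc d * b
  drop a b (ℚᵘ.*≤* le) = begin
    a                  ≤⟨ m≤n*m a (suc p) ⟩
    suc p * a          ≡⟨ *-identityʳ _ ⟨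
    suc p * a * 1      ≤⟨ ℤ.drop‿+≤+ (subst₂ ℤ._≤_ (pos-*-* (suc p) a 1) (sym (ℤ.pos-* b (suc d * 1))) le) ⟩
    b * (suc d * 1)    ≡⟨ cong (b *_) (*-identityʳ (suc d)) ⟩
    b * suc d          ≡⟨ *-comm b (suc d) ⟩
    suc d * b          ∎

-- Here the numerator serves as `D`, because the denominator is at least 1.
upper-bound-ℕ : ∀ C → 0ℚ ℚ.< C →
                ∃[ D ] (∀ a b → fromℕ b ℚ.≤ C ℚ.* fromℕ a → b ℕ.≤ D * a)
upper-bound-ℕ (mkℚ (+ zero) _ _)      0<C = contradiction (ℚ.drop-*<* 0<C) λ { (ℤ.+<+ ()) }
upper-bound-ℕ (mkℚ ℤ.-[1+ _ ] _ _)    0<C = contradiction (ℚ.drop-*<* 0<C) λ ()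
upper-bound-ℕ C@(mkℚ (+ suc p) d _)   0<C = suc p , λ a b le → drop a b
  (ℚᵘ.≤-respˡ-≃ (toℚᵘ-fromℕ b) (ℚᵘ.≤-respʳ-≃ (toℚᵘ-*-fromℕ C a) (ℚ.toℚᵘ-mono-≤ le)))
  where
  open ≤-Reasoning
  drop : ∀ a b → mkℚᵘ (+ b) 0 ℚᵘ.≤ mkℚᵘ (+ suc p) d ℚᵘ.* mkℚᵘ (+ a) 0 → b ℕ.≤ suc p * a
  drop a b (ℚᵘ.*≤* le) = begin
    b                  ≤⟨ m≤m*n b (suc d * 1) ⟩
    b * (suc d * 1)    ≤⟨ ℤ.drop‿+≤+ (subst₂ ℤ._≤_ (sym (ℤ.pos-* b (suc d * 1))) (pos-*-* (suc p) a 1) le) ⟩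
    suc p * a * 1      ≡⟨ *-identityʳ _ ⟩
    suc p * a          ∎

-- Paths and strongly connected components

module _ {n} (S : List⁺ (Matrix n)) where

  Word : ∀ {t} → Vec (Matrix n) t → Set
  Word = All (_∈ˡ toList S)

  Reach : Fin n → Fin n → Set
  Reach = Star (Edge S)

  word∈words : (v : Vec (Matrix n) t) → Word v → v ∈ˡ words (toList S) t
  word∈words []      []       = here refl
  word∈words (A ∷ v) (a ∷ as) = ∈-cartesianProductWith⁺ _∷_ a (word∈words v as)

  words⇒Word : ∀ t {v : Vec (Matrix n) t} → v ∈ˡ words (toList S) t → Word v
  words⇒Word zero    {[]} _ = []
  words⇒Word (suc t) v∈
    with _ , _ , a , as , refl ← ∈-cartesianProductWith⁻ _∷_ (toList S) (words (toList S) t) v∈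
    = a ∷ words⇒Word t as

  norm≤maxₜ : (v : Vec (Matrix n) t) → Word v → ‖ product v ‖ ℕ.≤ maxₜ S t
  norm≤maxₜ v as = ListAll.lookup (xs≤max 0 _) (∈-map⁺ (‖_‖ ∘ product) (word∈words v as))

  maxₜ≤ : ∀ t {b} → (∀ (v : Vec (Matrix n) t) → Word v → ‖ product v ‖ ℕ.≤ b) → maxₜ S t ℕ.≤ b
  maxₜ≤ t bound = max≤v⁺ z≤n
    (ListAll.map⁺ (ListAll.tabulate λ {v} v∈ → bound v (words⇒Word t v∈)))

  -- One letter is chosen for each edge; the path so spelled is one positive term of the entry.
  reach⇒word : ∀ {i j} → Reach i j → ∃[ t ] ∃[ v ] Word {t} v × 1 ℕ.≤ product v i j
  reach⇒word {i} ε = 0 , [] , [] , ≤-reflexive (sym (𝟙-diagonal i))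
  reach⇒word {i} {k} (_◅_ {j = j} e r) with A , a , 0<Aij ← find e | t , v , as , 1≤ ← reach⇒word r =
    suc t , A ∷ v , a ∷ as , ≤-trans (*-mono-≤ 0<Aij 1≤) (term≤∑ (λ l → A i l * product v l k) j)

  power-word : (v : Vec (Matrix n) t) → Word v → ∀ m → Word (concat (replicate m v))
  power-word v as zero    = []
  power-word v as (suc m) = ++⁺ as (power-word v as m)

  -- Entries of products inside one component

  module _ (k D : ℕ) (polynomial : ∀ t → .{{NonZero t}} → maxₜ S t ℕ.≤ D * t ℕ.^ k) where

    diagonal≤1 : (v : Vec (Matrix n) t) → Word v → ∀ i → product v i i ℕ.≤ 1
    -- The powers of the empty word have length 0, where `polynomial` says nothing.
    diagonal≤1 []        _  i = ≤-reflexive (𝟙-diagonal i)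
    diagonal≤1 {suc t} v as i = ≮⇒≥ λ 2≤ →
      -- The power has length `m * suc t`; the factor `suc t ^ k` of the polynomial bound there is
      -- moved into the coefficient that `2 ^ m` must beat.
      let m , m≢0 , m-large = exponential-beats-polynomial (D * suc t ℕ.^ k) k
          v^m = concat (replicate m v)
      in <-irrefl refl (begin-strict
        2 ℕ.^ m                          ≤⟨ product-power v i 2≤ m ⟩
        product v^m i i                  ≤⟨ entry≤norm (product v^m) i i ⟩
        ‖ product v^m ‖                  ≤⟨ norm≤maxₜ v^m (power-word v as m) ⟩
        maxₜ S (m * suc t)               ≤⟨ polynomial (m * suc t) {{m*n≢0 m (suc t) {{m≢0}}}} ⟩
        D * (m * suc t) ℕ.^ k            ≡⟨ cong (D *_) (trans (^-distribʳ-* k m (suc t)) (*-comm (m ℕ.^ k) _)) ⟩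
        D * (suc t ℕ.^ k * m ℕ.^ k)      ≡⟨ *-assoc D _ _ ⟨
        D * suc t ℕ.^ k * m ℕ.^ k        <⟨ m-large ⟩
        2 ℕ.^ m                          ∎)
      where open ≤-Reasoning

    -- A word leading back from `j` to `i` closes the paths without lowering their count, so the
    -- diagonal bound applies.
    connected≤1 : (v : Vec (Matrix n) t) → Word v → ∀ {i j} → StronglyConnected S i j → product v i j ℕ.≤ 1
    connected≤1 v as {i} {j} (_ , j→i) with _ , w , bs , 1≤ ← reach⇒word j→i = begin
      product v i j                  ≡⟨ *-identityʳ _ ⟨
      product v i j * 1              ≤⟨ *-monoʳ-≤ (product v i j) 1≤ ⟩
      product v i j * product w j i  ≤⟨ product-++ v w i j i ⟩
      product (v ++ w) i i           ≤⟨ diagonal≤1 (v ++ w) (++⁺ as bs) i ⟩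
      1                              ∎
      where open ≤-Reasoning

  M : ℕ
  M = max 0 (map ‖_‖ (toList S))

  letter≤M : ∀ {A} → A ∈ˡ toList S → ‖ A ‖ ℕ.≤ M
  letter≤M a = ListAll.lookup (xs≤max 0 _) (∈-map⁺ ‖_‖ a)

  -- Paths leaving a component

  module _ (reach? : ∀ i j → Dec (Reach i j)) where

    Supported : Fin n → Vector ℕ n → Set
    Supported i q = ∀ l → 0 ℕ.< q l → StronglyConnected S i l

    -- The bound covers all continuations, not just the entries of `q`, so that it survives reading
    -- a letter `A`: that letter is prepended to the continuation.
    Tame : Fin n → Vector ℕ n → Set
    Tame i q = ∀ {t} (v : Vec (Matrix n) t) → Word v →
               ∀ j → StronglyConnected S i j → q ∙ flip (product v) j ℕ.≤ 1

    -- Testing the way back to `i` suffices: positive entries of the vectors restricted below are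
    -- reachable from `i` already.
    restrict : Fin n → Vector ℕ n → Vector ℕ n
    restrict i q j = if does (reach? j i) then q j else 0

    restrict-≤ : ∀ i q j → restrict i q j ℕ.≤ q j
    restrict-≤ i q j with does (reach? j i)
    ... | true  = ≤-refl
    ... | false = z≤n

    -- An entry above 1 would lie in the support, hence in the component of `i`, where the empty
    -- continuation bounds it.
    tame≤1 : ∀ {i q} → Supported i q → Tame i q → ∀ l → q l ℕ.≤ 1
    tame≤1 {i} {q} supp tame l = ≮⇒≥ λ 1<ql → <⇒≱ 1<ql (begin
      q l               ≡⟨ *-identityʳ (q l) ⟨
      q l * 1           ≡⟨ cong (q l *_) (𝟙-diagonal l) ⟨
      q l * 𝟙 l l       ≤⟨ term≤∑ (λ m → q m * 𝟙 m l) l ⟩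
      q ∙ flip 𝟙 l      ≤⟨ tame [] [] l (supp l (<⇒≤ 1<ql)) ⟩
      1                 ∎)
      where open ≤-Reasoning

    -- `below` is the induction hypothesis for the components strictly below that of `i`. The cap
    -- `T` on lengths lets one `B` serve for every remaining suffix.
    module _ (i : Fin n) (T B : ℕ)
             (below : ∀ j → Reach i j → ¬ Reach j i →
                      ∀ {t} (v : Vec (Matrix n) t) → Word v → t ℕ.≤ T → rowSum (product v) j ℕ.≤ B)
      where

      -- The vector q counts the paths that have stayed in the component of i
      -- so far.  Reading a letter A turns it into qA, whose part outside that
      -- component has total weight at most ‖ A ‖ and continues with row sums
      -- at most B.
      component-bound : ∀ {t} (v : Vec (Matrix n) t) → Word v → t ℕ.≤ T →
                        ∀ q → Supported i q → Tame i q → q ∙ rowSum (product v) ℕ.≤ n + t * (M * B)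
      component-bound [] _ _ q supp tame = begin
        q ∙ rowSum 𝟙       ≤⟨ ∑-bounded _ (λ l → *-mono-≤ (tame≤1 supp tame l) (≤-reflexive (rowSum-𝟙 l))) ⟩
        n * 1              ≡⟨ *-identityʳ n ⟩
        n                  ≡⟨ +-identityʳ n ⟨
        n + 0              ∎
        where open ≤-Reasoning
      component-bound {suc t} (A ∷ v) (a ∷ as) t<T q supp tame = begin
        q ∙ rowSum (A ⊗ product v)         ≡⟨ ∑-cong (λ l → cong (q l *_) (rowSum-⊗ A (product v) l)) ⟩
        q ∙ (λ l → A l ∙ R)                ≡⟨ ∙-assoc q A R ⟩
        qA ∙ R                             ≤⟨ ∑-mono split ⟩
        (∑ λ j → qA′ j * R j + qA j * B)   ≡⟨ ∑-distrib-+ (λ j → qA′ j * R j) (λ j → qA j * B) ⟩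
        qA′ ∙ R + (∑ λ j → qA j * B)       ≤⟨ +-mono-≤ (component-bound v as (<⇒≤ t<T) qA′ supp′ tame′) leaving ⟩
        n + t * (M * B) + M * B            ≡⟨ trans (+-assoc n _ _) (cong (λ x → n + x) (+-comm _ (M * B))) ⟩
        n + suc t * (M * B)                ∎
        where
        open ≤-Reasoning
        R qA qA′ : Vector ℕ n
        R   = rowSum (product v)
        qA  = λ j → q ∙ flip A j
        qA′ = restrict i qA

        step : ∀ j → 0 ℕ.< qA j → Reach i j
        step j 0<qA with l , 0<term ← ∑-positive _ 0<qA
                    with 0<ql , 0<Alj ← *-positive (q l) (A l j) 0<term
                    with i→l , _ ← supp l 0<ql =
          i→l ◅◅ (lose a 0<Alj ◅ ε)

        split : ∀ j → qA j * R j ℕ.≤ qA′ j * R j + qA j * B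
        split j with reach? j i
        ... | yes _   = m≤m+n _ _
        -- Only a positive entry is known to be reachable from `i`, as `below` requires; a zero
        -- entry contributes nothing.
        ... | no ¬j→i with qA j in eq
        ...   | zero  = z≤n
        ...   | suc x = *-monoʳ-≤ (suc x) (below j (step j (subst (0 ℕ.<_) (sym eq) z<s)) ¬j→i v as (<⇒≤ t<T))

        supp′ : Supported i qA′
        supp′ j 0<qA′ with reach? j i
        ... | yes j→i = step j 0<qA′ , j→i

        tame′ : Tame i qA′
        tame′ w bs j i~j = begin
          qA′ ∙ flip (product w) j              ≤⟨ ∑-mono (λ l → *-monoˡ-≤ (product w l j) (restrict-≤ i qA l)) ⟩
          qA ∙ flip (product w) j               ≡⟨ ∙-assoc q A (flip (product w) j) ⟨
          q ∙ flip (product (A ∷ w)) j          ≤⟨ tame (A ∷ w) (a ∷ bs) j i~j ⟩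
          1                                     ∎

        leaving : (∑ λ j → qA j * B) ℕ.≤ M * B
        leaving = begin
          (∑ λ j → qA j * B)              ≡⟨ *-distribʳ-∑ B qA ⟨
          -- As `q` is at most 1 everywhere, the total weight of `qA` is at most the sum of all
          -- entries of `A`.
          ∑ qA * B                        ≤⟨ *-monoˡ-≤ B (∑-mono λ j → ∑-mono λ l → *-monoˡ-≤ (A l j) (tame≤1 supp tame l)) ⟩
          (∑ λ j → ∑ λ l → 1 * A l j) * B ≡⟨ cong (_* B) (∑-comm λ j l → 1 * A l j) ⟩
          (∑ λ l → ∑ λ j → 1 * A l j) * B ≡⟨ cong (_* B) (∑-cong λ l → ∑-cong λ j → *-identityˡ (A l j)) ⟩
          ‖ A ‖ * B                       ≤⟨ *-monoˡ-≤ B (letter≤M a) ⟩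
          M * B                           ∎

    -- The summand `n` bounds the paths that stay in their component; the others leave at one of at
    -- most `T` times, with weight at most `M`, into a component of smaller rank. No node has rank
    -- 0, and the value 0 there makes the bound for `d = 1` constant in `T`, which yields degree
    -- `d - 1` instead of `d`.
    rowBound : ℕ → ℕ → ℕ
    rowBound T zero    = 0
    rowBound T (suc d) = n + T * (M * rowBound T d)

    rowBound-coefficient : ℕ → ℕ
    rowBound-coefficient zero    = n
    rowBound-coefficient (suc d) = n + M * rowBound-coefficient d

    rowBound-polynomial : ∀ T → .{{NonZero T}} → ∀ d →
                          rowBound T (suc d) ℕ.≤ rowBound-coefficient d * T ℕ.^ d
    rowBound-polynomial T zero = ≤-reflexive
      (solve 3 (λ N t m → N :+ t :* (m :* con 0) := N :* con 1) refl n T M)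
      where open +-*-Solver
    rowBound-polynomial T (suc d) = begin
      n + T * (M * rowBound T (suc d))       ≤⟨ +-mono-≤ (m≤m*n n (T ℕ.^ suc d) {{m^n≢0 T (suc d)}}) (*-monoʳ-≤ T (*-monoʳ-≤ M (rowBound-polynomial T d))) ⟩
      n * T ℕ.^ suc d + T * (M * (E * T ℕ.^ d)) ≡⟨ cong (λ x → n * T ℕ.^ suc d + x) (solve 4 (λ t m e p → t :* (m :* (e :* p)) := m :* e :* (t :* p)) refl T M E (T ℕ.^ d)) ⟩
      n * T ℕ.^ suc d + M * E * T ℕ.^ suc d  ≡⟨ *-distribʳ-+ (T ℕ.^ suc d) n (M * E) ⟨
      (n + M * E) * T ℕ.^ suc d              ∎
      where
      open ≤-Reasoning
      open +-*-Solver
      E = rowBound-coefficient d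

    -- Rank: the number of representatives reachable from a node

    module _ {m} (c : Fin m → Fin n) where

      reachable : Fin n → Subset m
      reachable i = tabulate λ x → does (reach? i (c x))

      ∈-reachable⁺ : ∀ {i x} → Reach i (c x) → x ∈ reachable i
      ∈-reachable⁺ {i} {x} r = lookup⇒[]= x _ (trans (lookup∘tabulate _ x) (dec-true (reach? i (c x)) r))

      ∈-reachable⁻ : ∀ {i x} → x ∈ reachable i → Reach i (c x)
      ∈-reachable⁻ {i} {x} x∈ with reach? i (c x) | trans (sym (lookup∘tabulate (λ y → does (reach? i (c y))) x)) ([]=⇒lookup x∈)
      ... | yes r | _ = r

      rank : Fin n → ℕ
      rank i = ∣ reachable i ∣

    -- A family of nodes meeting every component stands in for the quotient. Repetitions are
    -- allowed, so that the same argument covers both the components and the family of all nodes.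
    module _ {m} (c : Fin m → Fin n) (representative : ∀ i → ∃[ x ] StronglyConnected S i (c x)) where

      rank-positive : ∀ i → 0 ℕ.< rank c i
      rank-positive i with x , i→x , _ ← representative i =
        ≤-trans z<s (x∈p⇒∣p-x∣<∣p∣ (∈-reachable⁺ c i→x))

      -- Whatever `j` reaches, `i` reaches; the representative of the component of `i` is lost,
      -- since through it `j` would get back to `i`.
      rank-decreases : ∀ i j → Reach i j → ¬ Reach j i → rank c j ℕ.< rank c i
      rank-decreases i j i→j ¬j→i with x , i→x , x→i ← representative i = p⊂q⇒∣p∣<∣q∣
        ( (λ y∈ → ∈-reachable⁺ c (i→j ◅◅ ∈-reachable⁻ c y∈))
        , x , ∈-reachable⁺ c i→x , λ x∈ → ¬j→i (∈-reachable⁻ c x∈ ◅◅ x→i))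

      module _ (k D : ℕ) (polynomial : ∀ t → .{{NonZero t}} → maxₜ S t ℕ.≤ D * t ℕ.^ k) where

        -- Induction on `d`, started at each node from the unit vector `𝟙 i`, which is tame by
        -- `connected≤1`. `T` stays fixed while words get shorter.
        rowSum≤ : ∀ T d i → rank c i ℕ.≤ d →
                  ∀ {t} (v : Vec (Matrix n) t) → Word v → t ℕ.≤ T → rowSum (product v) i ℕ.≤ rowBound T d
        rowSum≤ T zero    i rank≤0 = contradiction (rank-positive i) (≤⇒≯ rank≤0)
        rowSum≤ T (suc d) i rank≤ {t} v as t≤T = begin
          rowSum (product v) i            ≡⟨ 𝟙-∙ i (rowSum (product v)) ⟨
          𝟙 i ∙ rowSum (product v)        ≤⟨ component-bound i T (rowBound T d) below v as t≤T (𝟙 i) supp tame ⟩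
          n + t * (M * rowBound T d)      ≤⟨ +-monoʳ-≤ n (*-monoˡ-≤ (M * rowBound T d) t≤T) ⟩
          rowBound T (suc d)              ∎
          where
          open ≤-Reasoning
          below : ∀ j → Reach i j → ¬ Reach j i →
                  ∀ {t} (v : Vec (Matrix n) t) → Word v → t ℕ.≤ T → rowSum (product v) j ℕ.≤ rowBound T d
          below j i→j ¬j→i = rowSum≤ T d j (s≤s⁻¹ (≤-trans (rank-decreases i j i→j ¬j→i) rank≤))

          supp : Supported i (𝟙 i)
          supp l 0<𝟙 with i ≟ l
          ... | yes refl = ε , ε

          tame : Tame i (𝟙 i)
          tame w bs j i~j = subst (ℕ._≤ 1) (sym (𝟙-∙ i (flip (product w) j)))
            (connected≤1 k D polynomial w bs i~j)

        maxₜ≤rowBound : ∀ t → maxₜ S t ℕ.≤ n * rowBound t m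
        maxₜ≤rowBound t = maxₜ≤ t λ v as →
          ∑-bounded (rowSum (product v)) λ i → rowSum≤ t m i (∣p∣≤n (reachable c i)) v as ≤-refl

  -- Comparison of the rate of growth with the number of representatives

  rate<representatives : (∀ i j → Dec (Reach i j)) → ∀ k L U →
    (∀ t → .{{NonZero t}} → t ℕ.^ k ℕ.≤ L * maxₜ S t) →
    (∀ t → .{{NonZero t}} → maxₜ S t ℕ.≤ U * t ℕ.^ k) →
    ∀ {m} (c : Fin m → Fin n) → (∀ i → ∃[ x ] StronglyConnected S i (c x)) → k ℕ.< m
  rate<representatives reach? k L U lower upper {m} c representative = go m growth
    where
    growth : ∀ t → .{{NonZero t}} → t ℕ.^ k ℕ.≤ L * (n * rowBound reach? t m)
    growth t = ≤-trans (lower t) (*-monoʳ-≤ L (maxₜ≤rowBound reach? c representative k U upper t))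

    go : ∀ m → (∀ t → .{{NonZero t}} → t ℕ.^ k ℕ.≤ L * (n * rowBound reach? t m)) → k ℕ.< m
    -- Without representatives the bound at `t = 1` reads `1 ≤ 0`.
    go zero growth = contradiction
      (subst₂ ℕ._≤_ (^-zeroˡ k) (trans (cong (L *_) (*-zeroʳ n)) (*-zeroʳ L)) (growth 1)) λ ()
    go (suc d) growth = s≤s (degree-≤ k d (L * (n * E)) λ t → begin
      t ℕ.^ k                                ≤⟨ growth t ⟩
      L * (n * rowBound reach? t (suc d))    ≤⟨ *-monoʳ-≤ L (*-monoʳ-≤ n (rowBound-polynomial reach? t d)) ⟩
      L * (n * (E * t ℕ.^ d))                ≡⟨ cong (L *_) (*-assoc n E _) ⟨
      L * (n * E * t ℕ.^ d)                  ≡⟨ *-assoc L (n * E) _ ⟨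
      L * (n * E) * t ℕ.^ d                  ∎)
      where
      open ≤-Reasoning
      E : ℕ
      E = rowBound-coefficient reach? d

  -- Double negation commutes with quantification over the finite type `Fin n`, so excluded middle
  -- can be taken pair by pair.
  ¬¬-reach? : ¬ ¬ (∀ i j → Dec (Reach i j))
  ¬¬-reach? = sequence applicative λ i → sequence applicative λ j → ¬¬-excluded-middle
    where applicative = RawMonad.rawApplicative ¬¬-Monad

≤-pred-ℤ : ∀ {k m} → k ℕ.< m → + k ≤ + m - + 1
≤-pred-ℤ {m = suc m} (s≤s k≤m) = ℤ.+≤+ k≤m

corollary5 : ∀ (n : ℕ) (S : List⁺ (Matrix n)) →
    IsJointSpectralRadius S 1ℚ →
    ∀ (k : ℕ) → IsRateOfGrowth S k →
    (∀ (I : ℕ) → NumberOfComponents S I → + k ≤ + I - + 1) ×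
    (+ k ≤ + n - + 1)
corollary5 n S _ k (C₁ , C₂ , 0<C₁ , 0<C₂ , rate) = components-bound , nodes-bound
  where
  lower = lower-bound-ℕ C₁ 0<C₁
  upper = upper-bound-ℕ C₂ 0<C₂

  bound : ∀ {m} (c : Fin m → Fin n) → (∀ i → ∃[ x ] StronglyConnected S i (c x)) → + k ≤ + m - + 1
  bound c representative = decidable-stable (_ ℤ.≤? _)
    (¬¬-map (λ reach? → ≤-pred-ℤ (rate<representatives S reach? k (proj₁ lower) (proj₁ upper)
      (λ t → proj₂ lower (t ℕ.^ k) (maxₜ S t) (proj₁ (rate t)))
      (λ t → proj₂ upper (t ℕ.^ k) (maxₜ S t) (proj₂ (rate t))) c representative)) (¬¬-reach? S))

  components-bound : ∀ I → NumberOfComponents S I → + k ≤ + I - + 1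
  -- A preimage of each number is chosen as representative; the one for `to i` has the same image as
  -- `i`, and injectivity puts it in the component of `i`.
  components-bound I numbering = bound (proj₁ ∘ strictlySurjective) λ i →
    to i , symmetric (injective (proj₂ (strictlySurjective (to i))))
    where open Bijection numbering using (to; injective; strictlySurjective)

  nodes-bound : + k ≤ + n - + 1
  -- Every node represents itself, so the family has `n` members.
  nodes-bound = bound (λ i → i) λ i → i , ε , ε
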